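{- Let $r>0$ be an integer and let $s_n(m)$ denote the (polynomially extended) number of ballot paths to $(n,m)$ avoiding $r$ consecutive $\rightarrow$ steps, as described in the context. Then for every integer $m\ge 0$, as an identity of formal power series in $t$, $$\sum_{n\geq 0}s_{n}(m)\,t^{n}=\frac{(1-t^{r})^{m}}{(1-t)^{m+2}}\Bigl(r t^{r}(1-t)+(1-t^{r})(1-2t)\Bigr).$$
   Context: For $m\ge n\ge 0$, $s_n(m)$ is the number of lattice paths from $(0,0)$ to $(n,m)$ with unit steps $\uparrow=(0,1)$ and $\rightarrow=(1,0)$ that stay weakly above the diagonal $y=x$ and contain no $r$ consecutive $\rightarrow$ steps; also $s_n(n-1)=0$ for $n>0$. (Equivalently, for $m\ge n$, $s_n(m)$ is the number of paths with steps $(1,1)$ and $(1,-1)$ from $(0,0)$ to $(n+m,m-n)$ staying weakly above the $x$-axis and avoiding $r$ consecutive down steps.) These numbers are extended to all integers $m$ by: $s_n(m)=0$ for all $m$ if $n<0$; $s_0(m)=1$ for all $m\in\mathbb{Z}$; and for $n>0$ the values $s_n(m)$ with $m<n-1$ are defined by requiring $s_{n}(m)=s_{n-1}(m)+s_{n}(m-1)-s_{n-r}(m-1)$ for all $m\in\mathbb{Z}$. For each $n$ the function $m\mapsto s_n(m)$ is then a polynomial in $m$. For $n>m+1$ the coefficient $s_n(m)$ in the generating function is this extended value, not a path count. -}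

module Defs where

open import Data.Nat.Base using (ℕ; zero; suc; pred) renaming (_+_ to _+ℕ_; _≤_ to _≤ℕ_)
import Data.Nat.Properties as ℕ
open import Data.Integer.Base using (ℤ; +_; -[1+_]; _+_; _-_; _*_; 0ℤ; 1ℤ)
import Data.Integer.Properties as ℤ
open import Data.Integer.Tactic.RingSolver using (solve-∀)
open import Data.List.Base using (List; []; _∷_; _++_; map; length; filter; replicate; inits)
open import Data.List.Relation.Unary.All using (All; all?)
open import Data.List.Relation.Binary.Infix.Heterogeneous using (Infix)
open import Data.List.Relation.Binary.Infix.Heterogeneous.Properties using (infix?)
open import Data.Product.Base using (_×_)
open import Relation.Binary.PropositionalEquality
  using (_≡_; refl; trans; cong; cong₂; _≗_)
open import Relation.Nullary using (¬_; Dec; yes; no; ¬?; _×-dec_)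

data Step : Set where
  ↑ ⇒ : Step

_≟_ : (a b : Step) → Dec (a ≡ b)
↑ ≟ ↑ = yes refl
↑ ≟ ⇒ = no λ ()
⇒ ≟ ↑ = no λ ()
⇒ ≟ ⇒ = yes refl

Path : Set
Path = List Step

-- Coordinates of the endpoint of a path starting at (0,0).
xEnd yEnd : Path → ℕ
xEnd p = length (filter (⇒ ≟_) p)
yEnd p = length (filter (↑ ≟_) p)

-- The lattice points visited by a path are the endpoints of its prefixes.
AboveDiagonal : Path → Set
AboveDiagonal p = All (λ q → xEnd q ≤ℕ yEnd q) (inits p)

Avoids : ℕ → Path → Set
Avoids r p = ¬ Infix _≡_ (replicate r ⇒) p

IsBallotPath : (r n m : ℕ) → Path → Set
IsBallotPath r n m p = (xEnd p ≡ n × yEnd p ≡ m) × AboveDiagonal p × Avoids r p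

isBallotPath? : ∀ r n m p → Dec (IsBallotPath r n m p)
isBallotPath? r n m p =
  ((xEnd p ℕ.≟ n) ×-dec (yEnd p ℕ.≟ m))
  ×-dec (all? (λ q → xEnd q ℕ.≤? yEnd q) (inits p)
  ×-dec ¬? (infix? _≟_ (replicate r ⇒) p))

-- All paths with a given number of steps, each listed once.
paths : ℕ → List Path
paths zero    = [] ∷ []
paths (suc l) = map (↑ ∷_) (paths l) ++ map (⇒ ∷_) (paths l)

-- A path to (n,m) has n + m steps.
#ballotPaths : (r n m : ℕ) → ℕ
#ballotPaths r n m = length (filter (isBallotPath? r n m) (paths (n +ℕ m)))

-- s r n m is s_n(m); it is meaningful for r > 0.
mutual

  s : (r n : ℕ) → ℤ → ℤ
  s r zero    m = 1ℤ
  s r (suc n) m = sFromDiagonal r n (m - + suc n)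

  -- sFromDiagonal r n d is s_N(N+d), where N = n+1.  On and above the
  -- diagonal (d ≥ 0) it counts paths, and s_N(N-1) = 0.  The last clause
  -- is the recurrence
  --   s_N(M) = s_{N-1}(M) + s_N(M-1) - s_{N-r}(M-1),   M = N-1-k = n-k,
  -- solved for s_N(M-1); here N - r = n - (r-1).
  sFromDiagonal : (r n : ℕ) → ℤ → ℤ
  sFromDiagonal r n (+ d)          = + #ballotPaths r (suc n) (suc n +ℕ d)
  sFromDiagonal r n -[1+ zero ]    = 0ℤ
  sFromDiagonal r n -[1+ suc k ]   =
    sFromDiagonal r n -[1+ k ] - s r n (+ n - + k)
      + sLagged r n (pred r) (+ n - + k - 1ℤ)

  -- sLagged r n j m is s_{n-j}(m), which is 0 when n - j is negative.
  sLagged : (r n j : ℕ) → ℤ → ℤ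
  sLagged r n       zero    m = s r n m
  sLagged r zero    (suc j) m = 0ℤ
  sLagged r (suc n) (suc j) m = sLagged r n j m

-- Formal power series over ℤ, given by their coefficients and compared
-- coefficientwise (_≗_).
Series : Set
Series = ℕ → ℤ

infixl 6 _⊕_ _⊖_
infixl 7 _⊛_ _⊘_
infixr 8 _⊛^_

const : ℤ → Series
const c zero    = c
const c (suc n) = 0ℤ

t : Series
t 1 = 1ℤ
t _ = 0ℤ

tail : Series → Series
tail f n = f (suc n)

_⊕_ _⊖_ : Series → Series → Series
(f ⊕ g) n = f n + g n
(f ⊖ g) n = f n - g n

-- The Cauchy product, (f ⊛ g)ₙ = Σ_{i ≤ n} fᵢ gₙ₋ᵢ.
_⊛_ : Series → Series → Series
(f ⊛ g) zero    = f 0 * g 0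
(f ⊛ g) (suc n) = f 0 * g (suc n) + (tail f ⊛ g) n

_⊛^_ : Series → ℕ → Series
f ⊛^ zero  = const 1ℤ
f ⊛^ suc k = f ⊛ f ⊛^ k

-- Long division.  This is the quotient only for divisors with constant
-- coefficient 1, see ⊘-correct.
_⊘_ : Series → Series → Series
(f ⊘ g) zero    = f 0
(f ⊘ g) (suc n) = ((tail f ⊖ const (f 0) ⊛ tail g) ⊘ g) n

private
  zero-⊛ : ∀ f g → (∀ n → f n ≡ 0ℤ) → ∀ n → (f ⊛ g) n ≡ 0ℤ
  zero-⊛ f g f≡0 zero    = trans (cong (_* g 0) (f≡0 0)) (ℤ.*-zeroˡ (g 0))
  zero-⊛ f g f≡0 (suc n) = cong₂ _+_
    (trans (cong (_* g (suc n)) (f≡0 0)) (ℤ.*-zeroˡ (g (suc n))))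
    (zero-⊛ (tail f) g (λ k → f≡0 (suc k)) n)

const-⊛ : ∀ c g n → (const c ⊛ g) n ≡ c * g n
const-⊛ c g zero    = refl
const-⊛ c g (suc n) =
  trans (cong (_+_ (c * g (suc n))) (zero-⊛ (tail (const c)) g (λ _ → refl) n))
        (ℤ.+-identityʳ _)

⊘-correct : ∀ f g → g 0 ≡ 1ℤ → (f ⊘ g) ⊛ g ≗ f
⊘-correct f g g₀≡1 zero    = trans (cong (f 0 *_) g₀≡1) (ℤ.*-identityʳ (f 0))
⊘-correct f g g₀≡1 (suc n) =
  trans (cong (_+_ (f 0 * g (suc n))) (⊘-correct (tail f ⊖ const (f 0) ⊛ tail g) g g₀≡1 n))
  (trans (cong (λ z → f 0 * g (suc n) + (f (suc n) - z)) (const-⊛ (f 0) (tail g) n))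
         (lemma (f 0 * g (suc n)) (f (suc n))))
  where
  lemma : ∀ a b → a + (b - a) ≡ b
  lemma = solve-∀

1-t^-constant : ∀ k → ((const 1ℤ ⊖ t) ⊛^ k) 0 ≡ 1ℤ
1-t^-constant zero    = refl
1-t^-constant (suc k) = trans (ℤ.*-identityˡ _) (1-t^-constant k)

{-# OPTIONS --safe #-}
module Submission where

-- Write S_m for the series Σ s_n(m) t^n, with m ≥ 0, and put
-- φ = (1 - t^r) / (1 - t) and D = t d/dt.  The recurrence for s says
-- (1 - t) S_{m+1} = (1 - t^r) S_m, that is S_{m+1} = φ S_m, so only S_0 is in
-- question.  It is determined by s_0 = 1 and s_n(n-1) = 0 for n > 0, which say
-- that S_0 has constant term 1 and that φ^n S_0 has no term in t^(n+1) for n ≥ 0.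
-- By Lagrange inversion the solution is S_0 = φ - D φ (lagrange).  The quotient
-- rule gives (φ - D φ) (1 - t)² = r t^r (1 - t) + (1 - t^r) (1 - 2t)  (G-Q²),
-- which turns φ^m (φ - D φ) into the stated closed form (F≗closedForm).
--
-- The recurrence for s (s-recurrence) is part of the definition below the
-- diagonal, and has to be proved for path counts weakly above it
-- (#ballotPaths-recurrence).  There a path is split by its last step.  Appending
-- ↑ to a ballot path always gives a ballot path.  Appending ⇒ to a ballot path to
-- (n-1 , m) gives either a ballot path or a path ending in r steps ⇒, and the
-- latter are exactly the q ↑ ⇒^r with q a ballot path to (n-r , m-1).
--
-- The comparison of s_n(m) with the coefficients of φ^m (φ - D φ) is by induction
-- on n.  For fixed n > 0 both satisfy the same first-order recurrence in m ≥ 0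
-- and both vanish at m = n - 1 ≥ 0, so they agree for all m ≥ 0; negative m
-- play no part.

open import Defs
open import Data.Nat.Base using (ℕ; zero; suc; _+_; _≤_; _<_; _>_; z≤n; s≤s; s≤s⁻¹)
import Data.Nat.Properties as ℕ
open import Data.Integer.Base as ℤ using (ℤ; +_; -[1+_]; 0ℤ; 1ℤ)
import Data.Integer.Properties as ℤ
open import Data.Integer.Tactic.RingSolver using (solve-∀)
open import Algebra.Bundles using (CommutativeRing)
import Algebra.Solver.Ring as RingSolver
open import Algebra.Solver.Ring.AlmostCommutativeRing
  using (fromCommutativeRing; _-Raw-AlmostCommutative⟶_)
open import Data.List.Base
  using (List; []; _∷_; _++_; _∷ʳ_; _∷ʳ′_; initLast; map; length; filter; replicate; inits)
open import Data.List.Properties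
  using ( map-++; length-++; length-map; ++-assoc; ++-identityʳ; ++-cancelʳ
        ; ∷-injectiveʳ; ∷ʳ-injective; ∷ʳ-injectiveˡ; ∷ʳ-injectiveʳ; filter-none)
open import Data.List.Membership.Propositional using (_∈_)
open import Data.List.Membership.Propositional.Properties
  using (∈-map⁺; ∈-map⁻; ∈-++⁺ˡ; ∈-++⁺ʳ; ∈-++⁻; ∈-filter⁺; ∈-filter⁻)
open import Data.List.Membership.Propositional.Properties.WithK using (unique∧set⇒bag)
open import Data.List.Relation.Binary.BagAndSetEquality using (∼bag⇒↭)
open import Data.List.Relation.Binary.Disjoint.Propositional using (Disjoint)
open import Data.List.Relation.Binary.Infix.Heterogeneous
  using (Infix; View; MkView; toView; fromView; _ⁱ++_)
open import Data.List.Relation.Binary.Infix.Heterogeneous.Properties using (infix?)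
open import Data.List.Relation.Binary.Permutation.Propositional.Properties using (↭-length)
open import Data.List.Relation.Binary.Pointwise as Pointwise using (Pointwise-≡⇒≡)
open import Data.List.Relation.Unary.All as All using (All; [])
open import Data.List.Relation.Unary.All.Properties using (∷ʳ⁺; ∷ʳ⁻)
open import Data.List.Relation.Unary.AllPairs as AllPairs using ()
open import Data.List.Relation.Unary.Any using (here)
open import Data.List.Relation.Unary.Unique.Propositional using (Unique)
import Data.List.Relation.Unary.Unique.Propositional.Properties as Unique
open import Data.Maybe.Base using (Maybe; just; nothing)
open import Data.Product.Base using (_,_; _×_; ∃-syntax; proj₁; proj₂)
open import Data.Sum.Base using (_⊎_; inj₁; inj₂)
open import Function.Bundles using (mk⇔)
open import Level using (0ℓ)
open import Relation.Binary.PropositionalEquality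
  using (_≡_; _≢_; _≗_; refl; sym; trans; cong; cong₂; subst; subst₂; module ≡-Reasoning)
open import Relation.Nullary using (¬_; yes; no)
open import Relation.Nullary.Negation using (contradiction)

open ≡-Reasoning

-- The ring of formal power series

-- Coefficientwise negation.
⊝_ : Series → Series
(⊝ f) n = ℤ.- f n

⊛-cong : ∀ {f f′ g g′} → f ≗ f′ → g ≗ g′ → f ⊛ g ≗ f′ ⊛ g′
⊛-cong f≗ g≗ zero    = cong₂ ℤ._*_ (f≗ 0) (g≗ 0)
⊛-cong f≗ g≗ (suc n) =
  cong₂ ℤ._+_ (cong₂ ℤ._*_ (f≗ 0) (g≗ (suc n))) (⊛-cong (λ k → f≗ (suc k)) g≗ n)

⊛-distribʳ-⊕ : ∀ h f g → (f ⊕ g) ⊛ h ≗ f ⊛ h ⊕ g ⊛ h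
⊛-distribʳ-⊕ h f g zero    = ℤ.*-distribʳ-+ (h 0) (f 0) (g 0)
⊛-distribʳ-⊕ h f g (suc n) = trans
  (cong (ℤ._+_ ((f 0 ℤ.+ g 0) ℤ.* h (suc n))) (⊛-distribʳ-⊕ h (tail f) (tail g) n))
  (rearrange (f 0) (g 0) (h (suc n)) _ _)
  where
  rearrange : ∀ a b c x y → (a ℤ.+ b) ℤ.* c ℤ.+ (x ℤ.+ y) ≡ (a ℤ.* c ℤ.+ x) ℤ.+ (b ℤ.* c ℤ.+ y)
  rearrange = solve-∀

⊛-scaleˡ : ∀ c f g n → ((λ k → c ℤ.* f k) ⊛ g) n ≡ c ℤ.* (f ⊛ g) n
⊛-scaleˡ c f g zero    = ℤ.*-assoc c (f 0) (g 0)
⊛-scaleˡ c f g (suc n) = trans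
  (cong (ℤ._+_ (c ℤ.* f 0 ℤ.* g (suc n))) (⊛-scaleˡ c (tail f) g n))
  (rearrange c (f 0) (g (suc n)) _)
  where
  rearrange : ∀ c a b x → c ℤ.* a ℤ.* b ℤ.+ c ℤ.* x ≡ c ℤ.* (a ℤ.* b ℤ.+ x)
  rearrange = solve-∀

⊛-assoc : ∀ f g h → (f ⊛ g) ⊛ h ≗ f ⊛ (g ⊛ h)
⊛-assoc f g h zero    = ℤ.*-assoc (f 0) (g 0) (h 0)
⊛-assoc f g h (suc n) = begin
  f₀g₀h ℤ.+ (((λ k → f 0 ℤ.* g (suc k)) ⊕ tail f ⊛ g) ⊛ h) n
    ≡⟨ cong (ℤ._+_ f₀g₀h) (⊛-distribʳ-⊕ h _ (tail f ⊛ g) n) ⟩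
  f₀g₀h ℤ.+ (((λ k → f 0 ℤ.* g (suc k)) ⊛ h) n ℤ.+ ((tail f ⊛ g) ⊛ h) n)
    ≡⟨ cong (ℤ._+_ f₀g₀h) (cong₂ ℤ._+_ (⊛-scaleˡ (f 0) (tail g) h n) (⊛-assoc (tail f) g h n)) ⟩
  f₀g₀h ℤ.+ (f 0 ℤ.* (tail g ⊛ h) n ℤ.+ (tail f ⊛ (g ⊛ h)) n)
    ≡⟨ rearrange (f 0) (g 0) (h (suc n)) _ _ ⟩
  f 0 ℤ.* (g 0 ℤ.* h (suc n) ℤ.+ (tail g ⊛ h) n) ℤ.+ (tail f ⊛ (g ⊛ h)) n ∎
  where
  f₀g₀h = f 0 ℤ.* g 0 ℤ.* h (suc n)
  rearrange : ∀ a b c x y →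
    a ℤ.* b ℤ.* c ℤ.+ (a ℤ.* x ℤ.+ y) ≡ a ℤ.* (b ℤ.* c ℤ.+ x) ℤ.+ y
  rearrange = solve-∀

-- The Cauchy product expanded from its other end.
⊛-sucʳ : ∀ f g n → (f ⊛ g) (suc n) ≡ (f ⊛ tail g) n ℤ.+ f (suc n) ℤ.* g 0
⊛-sucʳ f g zero    = refl
⊛-sucʳ f g (suc n) = trans
  (cong (ℤ._+_ (f 0 ℤ.* g (suc (suc n)))) (⊛-sucʳ (tail f) g n))
  (sym (ℤ.+-assoc (f 0 ℤ.* g (suc (suc n))) _ _))

⊛-comm : ∀ f g → f ⊛ g ≗ g ⊛ f
⊛-comm f g zero    = ℤ.*-comm (f 0) (g 0)
⊛-comm f g (suc n) = begin
  f 0 ℤ.* g (suc n) ℤ.+ (tail f ⊛ g) n ≡⟨ ℤ.+-comm _ ((tail f ⊛ g) n) ⟩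
  (tail f ⊛ g) n ℤ.+ f 0 ℤ.* g (suc n) ≡⟨ cong₂ ℤ._+_ (⊛-comm (tail f) g n) (ℤ.*-comm (f 0) _) ⟩
  (g ⊛ tail f) n ℤ.+ g (suc n) ℤ.* f 0 ≡⟨ ⊛-sucʳ g f n ⟨
  (g ⊛ f) (suc n) ∎

⊛-identityˡ : ∀ f → const 1ℤ ⊛ f ≗ f
⊛-identityˡ f n = trans (const-⊛ 1ℤ f n) (ℤ.*-identityˡ (f n))

const-0 : ∀ n → const 0ℤ n ≡ 0ℤ
const-0 zero    = refl
const-0 (suc n) = refl

seriesRing : CommutativeRing 0ℓ 0ℓ
seriesRing = record
  { Carrier = Series ; _≈_ = _≗_ ; _+_ = _⊕_ ; _*_ = _⊛_ ; -_ = ⊝_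
  ; 0# = const 0ℤ ; 1# = const 1ℤ
  ; isCommutativeRing = record
    { isRing = record
      { +-isAbelianGroup = record
        { isGroup = record
          { isMonoid = record
            { isSemigroup = record
              { isMagma = record
                { isEquivalence = record
                  { refl  = λ _ → refl
                  ; sym   = λ eq n → sym (eq n)
                  ; trans = λ eq eq′ n → trans (eq n) (eq′ n)
                  }
                ; ∙-cong = λ eq eq′ n → cong₂ ℤ._+_ (eq n) (eq′ n)
                }
              ; assoc = λ f g h n → ℤ.+-assoc (f n) (g n) (h n)
              }
            ; identity =
                (λ f n → trans (cong (λ z → z ℤ.+ f n) (const-0 n)) (ℤ.+-identityˡ (f n)))
              , (λ f n → trans (cong (ℤ._+_ (f n)) (const-0 n)) (ℤ.+-identityʳ (f n)))
            }
          ; inverse =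
              (λ f n → trans (ℤ.+-inverseˡ (f n)) (sym (const-0 n)))
            , (λ f n → trans (ℤ.+-inverseʳ (f n)) (sym (const-0 n)))
          ; ⁻¹-cong = λ eq n → cong ℤ.-_ (eq n)
          }
        ; comm = λ f g n → ℤ.+-comm (f n) (g n)
        }
      ; *-cong = ⊛-cong
      ; *-assoc = ⊛-assoc
      ; *-identity =
          ⊛-identityˡ
        , (λ f n → trans (⊛-comm f (const 1ℤ) n) (⊛-identityˡ f n))
      ; distrib =
          (λ h f g n → trans (⊛-comm h (f ⊕ g) n)
            (trans (⊛-distribʳ-⊕ h f g n) (cong₂ ℤ._+_ (⊛-comm f h n) (⊛-comm g h n))))
        , ⊛-distribʳ-⊕
      }
    ; *-comm = ⊛-comm
    }
  }

open CommutativeRing seriesRing using (*-congˡ; *-congʳ)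

-- The embedding of ℤ as the constant series.  With it as the coefficient
-- homomorphism, the ring solver can test coefficients for equality, which is
-- not decidable for series; cancellation of terms depends on that test.
constHom : CommutativeRing.rawRing ℤ.+-*-commutativeRing
           -Raw-AlmostCommutative⟶ fromCommutativeRing seriesRing
constHom = record
  { ⟦_⟧    = const
  ; +-homo = λ { a b zero → refl ; a b (suc n) → refl }
  ; *-homo = λ { a b zero    → refl
               ; a b (suc n) → sym (trans (const-⊛ a (const b) (suc n)) (ℤ.*-zeroʳ a)) }
  ; -‿homo = λ { a zero → refl ; a (suc n) → refl }
  ; 0-homo = λ _ → refl
  ; 1-homo = λ _ → refl
  }

const≟ : ∀ a b → Maybe (const a ≗ const b)
const≟ a b with a ℤ.≟ b
... | yes refl = just (λ _ → refl)
... | no  _    = nothing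

open RingSolver (CommutativeRing.rawRing ℤ.+-*-commutativeRing)
  (fromCommutativeRing seriesRing) constHom const≟
  using (solve; _:=_; _:*_; _:+_; _:-_; :-_; con)

⊛^-+ : ∀ f a b → f ⊛^ (a + b) ≗ f ⊛^ a ⊛ f ⊛^ b
⊛^-+ f zero    b n = sym (⊛-identityˡ (f ⊛^ b) n)
⊛^-+ f (suc a) b n = trans (*-congˡ {f} (⊛^-+ f a b) n) (sym (⊛-assoc f (f ⊛^ a) (f ⊛^ b) n))

⊛^-distrib-⊛ : ∀ f g k → (f ⊛ g) ⊛^ k ≗ f ⊛^ k ⊛ g ⊛^ k
⊛^-distrib-⊛ f g zero    n = sym (⊛-identityˡ (const 1ℤ) n)
⊛^-distrib-⊛ f g (suc k) n = trans (*-congˡ {f ⊛ g} (⊛^-distrib-⊛ f g k) n)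
  (solve 4 (λ f g x y → f :* g :* (x :* y) := f :* x :* (g :* y))
    (λ _ → refl) f g (f ⊛^ k) (g ⊛^ k) n)

⊛^-cong : ∀ {f g} k → f ≗ g → f ⊛^ k ≗ g ⊛^ k
⊛^-cong zero    eq n = refl
⊛^-cong (suc k) eq = ⊛-cong eq (⊛^-cong k eq)

-- A series with constant coefficient 1 is invertible, hence cancellable.
⊛-cancelʳ : ∀ f g h → h 0 ≡ 1ℤ → f ⊛ h ≗ g ⊛ h → f ≗ g
⊛-cancelʳ f g h h₀≡1 fh≗gh n = begin
  f n               ≡⟨ multiply f n ⟩
  (f ⊛ h ⊛ h⁻¹) n   ≡⟨ *-congʳ {h⁻¹} fh≗gh n ⟩
  (g ⊛ h ⊛ h⁻¹) n   ≡⟨ multiply g n ⟨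
  g n               ∎
  where
  h⁻¹ = const 1ℤ ⊘ h
  multiply : ∀ f → f ≗ f ⊛ h ⊛ h⁻¹
  multiply f n = begin
    f n                    ≡⟨ ⊛-identityˡ f n ⟨
    (const 1ℤ ⊛ f) n       ≡⟨ *-congʳ {f} (⊘-correct (const 1ℤ) h h₀≡1) n ⟨
    (h⁻¹ ⊛ h ⊛ f) n        ≡⟨ solve 3 (λ i h f → i :* h :* f := f :* h :* i) (λ _ → refl) h⁻¹ h f n ⟩
    (f ⊛ h ⊛ h⁻¹) n        ∎

-- Multiplication by t shifts the coefficients by one place.
t-⊛ : ∀ f n → (t ⊛ f) (suc n) ≡ f n
t-⊛ f n = begin
  0ℤ ℤ.* f (suc n) ℤ.+ (tail t ⊛ f) n ≡⟨ ℤ.+-identityˡ _ ⟩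
  (tail t ⊛ f) n                      ≡⟨ *-congʳ {f} (λ { zero → refl ; (suc k) → refl }) n ⟩
  (const 1ℤ ⊛ f) n                    ≡⟨ ⊛-identityˡ f n ⟩
  f n                                 ∎

-- Lagrange inversion

-- The derivation t d/dt, which multiplies the n-th coefficient by n.
D : Series → Series
D f n = + n ℤ.* f n

-- The Leibniz rule.
D-⊛ : ∀ f g → D (f ⊛ g) ≗ D f ⊛ g ⊕ f ⊛ D g
D-⊛ f g zero    = rearrange (f 0) (g 0)
  where
  rearrange : ∀ a b → 0ℤ ℤ.* (a ℤ.* b) ≡ 0ℤ ℤ.* a ℤ.* b ℤ.+ a ℤ.* (0ℤ ℤ.* b)
  rearrange = solve-∀
D-⊛ f g (suc n) = begin
  + suc n ℤ.* (f 0 ℤ.* g (suc n) ℤ.+ X)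
    ≡⟨ rearrange (+ n) (f 0) (g (suc n)) X ⟩
  + n ℤ.* X ℤ.+ X ℤ.+ f 0 ℤ.* (+ suc n ℤ.* g (suc n))
    ≡⟨ cong (λ z → z ℤ.+ X ℤ.+ f 0 ℤ.* D g (suc n)) (D-⊛ (tail f) g n) ⟩
  Y ℤ.+ Z ℤ.+ X ℤ.+ f 0 ℤ.* (+ suc n ℤ.* g (suc n))
    ≡⟨ rearrange′ X Y Z (f 0 ℤ.* (+ suc n ℤ.* g (suc n))) (f 0) (g (suc n)) ⟩
  0ℤ ℤ.* f 0 ℤ.* g (suc n) ℤ.+ (Y ℤ.+ X) ℤ.+ (f 0 ℤ.* (+ suc n ℤ.* g (suc n)) ℤ.+ Z)
    ≡⟨ cong (λ z → 0ℤ ℤ.* f 0 ℤ.* g (suc n) ℤ.+ z ℤ.+ (f ⊛ D g) (suc n)) tail-D ⟨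
  (D f ⊛ g ⊕ f ⊛ D g) (suc n) ∎
  where
  X = (tail f ⊛ g) n
  Y = (D (tail f) ⊛ g) n
  Z = (tail f ⊛ D g) n
  expand : ∀ n x → (1ℤ ℤ.+ n) ℤ.* x ≡ n ℤ.* x ℤ.+ x
  expand = solve-∀
  tail-D : (tail (D f) ⊛ g) n ≡ Y ℤ.+ X
  tail-D = trans (*-congʳ {g} (λ k → expand (+ k) (f (suc k))) n)
                 (⊛-distribʳ-⊕ g (D (tail f)) (tail f) n)
  rearrange : ∀ n a b x →
    (1ℤ ℤ.+ n) ℤ.* (a ℤ.* b ℤ.+ x) ≡ n ℤ.* x ℤ.+ x ℤ.+ a ℤ.* ((1ℤ ℤ.+ n) ℤ.* b)
  rearrange = solve-∀
  rearrange′ : ∀ x y z w a b →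
    y ℤ.+ z ℤ.+ x ℤ.+ w ≡ 0ℤ ℤ.* a ℤ.* b ℤ.+ (y ℤ.+ x) ℤ.+ (w ℤ.+ z)
  rearrange′ = solve-∀

D-⊖ : ∀ f g → D (f ⊖ g) ≗ D f ⊖ D g
D-⊖ f g n = distrib (+ n) (f n) (g n)
  where
  distrib : ∀ c a b → c ℤ.* (a ℤ.- b) ≡ c ℤ.* a ℤ.- c ℤ.* b
  distrib = solve-∀

D-cong : ∀ {f g} → f ≗ g → D f ≗ D g
D-cong eq n = cong (ℤ._*_ (+ n)) (eq n)

D-const : ∀ c → D (const c) ≗ const 0ℤ
D-const c zero    = refl
D-const c (suc n) = ℤ.*-zeroʳ (+ suc n)

D-t : D t ≗ t
D-t zero          = refl
D-t (suc zero)    = refl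
D-t (suc (suc n)) = ℤ.*-zeroʳ (+ suc (suc n))

-- The power rule.
D-⊛^ : ∀ f k → D (f ⊛^ suc k) ≗ const (+ suc k) ⊛ (f ⊛^ k ⊛ D f)
D-⊛^ f zero    n = begin
  D (f ⊛ const 1ℤ) n
    ≡⟨ D-cong {g = f} (solve 1 (λ f → f :* con 1ℤ := f) (λ _ → refl) f) n ⟩
  D f n
    ≡⟨ solve 1 (λ f′ → f′ := con 1ℤ :* (con 1ℤ :* f′)) (λ _ → refl) (D f) n ⟩
  (const 1ℤ ⊛ (const 1ℤ ⊛ D f)) n ∎
D-⊛^ f (suc k) n = begin
  D (f ⊛ f ⊛^ suc k) n
    ≡⟨ D-⊛ f (f ⊛^ suc k) n ⟩
  (D f ⊛ f ⊛^ suc k) n ℤ.+ (f ⊛ D (f ⊛^ suc k)) n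
    ≡⟨ cong (ℤ._+_ ((D f ⊛ f ⊛^ suc k) n)) (*-congˡ {f} (D-⊛^ f k) n) ⟩
  (D f ⊛ f ⊛^ suc k) n ℤ.+ (f ⊛ (const (+ suc k) ⊛ (f ⊛^ k ⊛ D f))) n
    ≡⟨ solve 4 (λ f f′ x c → f′ :* (f :* x) :+ f :* (c :* (x :* f′))
                          := (con 1ℤ :+ c) :* (f :* x :* f′))
         (λ _ → refl) f (D f) (f ⊛^ k) (const (+ suc k)) n ⟩
  ((const 1ℤ ⊕ const (+ suc k)) ⊛ (f ⊛^ suc k ⊛ D f)) n
    ≡⟨ *-congʳ {f ⊛^ suc k ⊛ D f} (λ { zero → refl ; (suc _) → refl }) n ⟩
  (const (+ suc (suc k)) ⊛ (f ⊛^ suc k ⊛ D f)) n ∎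

D-t^ : ∀ r → D (t ⊛^ suc r) ≗ const (+ suc r) ⊛ t ⊛^ suc r
D-t^ r n = trans (D-⊛^ t r n) (*-congˡ {const (+ suc r)}
  (λ k → trans (*-congˡ {t ⊛^ r} D-t k) (⊛-comm (t ⊛^ r) t k)) n)

-- The instance of Lagrange inversion behind the closed form: as
-- D (φ^N) = N φ^(N-1) D φ, N times the coefficient of t^N in φ^(N-1) (φ - D φ)
-- is N [t^N] φ^N - [t^N] D (φ^N) = 0, where N = n + 1.
lagrange : ∀ φ n → (φ ⊛^ n ⊛ (φ ⊖ D φ)) (suc n) ≡ 0ℤ
lagrange φ n = ℤ.*-cancelˡ-≡ (+ suc n) _ 0ℤ (begin
  N ℤ.* (φ ⊛^ n ⊛ (φ ⊖ D φ)) (suc n)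
    ≡⟨ const-⊛ N (φ ⊛^ n ⊛ (φ ⊖ D φ)) (suc n) ⟨
  (const N ⊛ (φ ⊛^ n ⊛ (φ ⊖ D φ))) (suc n)
    ≡⟨ solve 4 (λ c x f f′ → c :* (x :* (f :- f′)) := c :* (f :* x) :- c :* (x :* f′)) (λ _ → refl)
         (const N) (φ ⊛^ n) φ (D φ) (suc n) ⟩
  (const N ⊛ φ ⊛^ suc n) (suc n) ℤ.- (const N ⊛ (φ ⊛^ n ⊛ D φ)) (suc n)
    ≡⟨ cong₂ ℤ._-_ (const-⊛ N (φ ⊛^ suc n) (suc n)) (sym (D-⊛^ φ n (suc n))) ⟩
  N ℤ.* (φ ⊛^ suc n) (suc n) ℤ.- N ℤ.* (φ ⊛^ suc n) (suc n)
    ≡⟨ ℤ.+-inverseʳ (N ℤ.* (φ ⊛^ suc n) (suc n)) ⟩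
  0ℤ
    ≡⟨ ℤ.*-zeroʳ N ⟨
  N ℤ.* 0ℤ ∎)
  where N = + suc n

-- The closed form and its recurrence

-- The parameter is r - 1, so that r > 0.
module ClosedForm (r′ : ℕ) where

  private
    r : ℕ
    r = suc r′

  -- W is the last factor of the closed form, and G is the candidate for Σ s_n(0) t^n.
  P Q W φ G : Series
  P = const 1ℤ ⊖ t ⊛^ r
  Q = const 1ℤ ⊖ t
  W = const (+ r) ⊛ t ⊛^ r ⊛ Q ⊕ P ⊛ (const 1ℤ ⊖ const (+ 2) ⊛ t)
  φ = P ⊘ Q
  G = φ ⊖ D φ

  -- The candidate for Σ s_n(m) t^n.
  F : ℕ → Series
  F m = φ ⊛^ m ⊛ G

  φQ≗P : φ ⊛ Q ≗ P
  φQ≗P = ⊘-correct P Q refl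

  D-P : D P ≗ ⊝ (const (+ r) ⊛ t ⊛^ r)
  D-P n = trans (D-⊖ (const 1ℤ) (t ⊛^ r) n) (trans (cong₂ ℤ._-_ (D-const 1ℤ n) (D-t^ r′ n))
    (solve 1 (λ x → con 0ℤ :- x := :- x) (λ _ → refl) (const (+ r) ⊛ t ⊛^ r) n))

  D-Q : D Q ≗ ⊝ t
  D-Q n = trans (D-⊖ (const 1ℤ) t n) (trans (cong₂ ℤ._-_ (D-const 1ℤ n) (D-t n))
    (solve 1 (λ x → con 0ℤ :- x := :- x) (λ _ → refl) t n))

  -- The quotient rule for φ = P / Q.
  Dφ-Q : D φ ⊛ Q ≗ ⊝ (const (+ r) ⊛ t ⊛^ r) ⊕ φ ⊛ t
  Dφ-Q n = begin
    (D φ ⊛ Q) n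
      ≡⟨ solve 4 (λ f′ f q q′ → f′ :* q := f′ :* q :+ f :* q′ :- f :* q′)
           (λ _ → refl) (D φ) φ Q (D Q) n ⟩
    (D φ ⊛ Q ⊕ φ ⊛ D Q) n ℤ.- (φ ⊛ D Q) n
      ≡⟨ cong₂ ℤ._-_
           (trans (sym (D-⊛ φ Q n)) (trans (D-cong φQ≗P n) (D-P n)))
           (*-congˡ {φ} D-Q n) ⟩
    (⊝ (const (+ r) ⊛ t ⊛^ r)) n ℤ.- (φ ⊛ ⊝ t) n
      ≡⟨ solve 3 (λ x f t → :- x :- f :* (:- t) := :- x :+ f :* t)
           (λ _ → refl) (const (+ r) ⊛ t ⊛^ r) φ t n ⟩
    (⊝ (const (+ r) ⊛ t ⊛^ r) ⊕ φ ⊛ t) n ∎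

  G-Q² : G ⊛ Q ⊛^ 2 ≗ W
  G-Q² n = begin
    (G ⊛ Q ⊛^ 2) n
      ≡⟨ solve 3 (λ f f′ q → (f :- f′) :* (q :* (q :* con 1ℤ)) := (f :* q) :* q :- (f′ :* q) :* q)
           (λ _ → refl) φ (D φ) Q n ⟩
    (φ ⊛ Q ⊛ Q) n ℤ.- (D φ ⊛ Q ⊛ Q) n
      ≡⟨ cong (ℤ._-_ ((φ ⊛ Q ⊛ Q) n)) (*-congʳ {Q} Dφ-Q n) ⟩
    (φ ⊛ Q ⊛ Q) n ℤ.- ((⊝ X ⊕ φ ⊛ t) ⊛ Q) n
      ≡⟨ solve 4 (λ f q x t → f :* q :* q :- (:- x :+ f :* t) :* q := x :* q :+ (f :* q) :* (q :- t))
           (λ _ → refl) φ Q X t n ⟩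
    (X ⊛ Q) n ℤ.+ (φ ⊛ Q ⊛ (Q ⊖ t)) n
      ≡⟨ cong (ℤ._+_ ((X ⊛ Q) n)) (⊛-cong φQ≗P
           (solve 1 (λ t → con 1ℤ :- t :- t := con 1ℤ :- con (+ 2) :* t) (λ _ → refl) t) n) ⟩
    W n ∎
    where X = const (+ r) ⊛ t ⊛^ r

  F≗closedForm : ∀ m → F m ≗ (P ⊛^ m ⊘ Q ⊛^ (m + 2)) ⊛ W
  F≗closedForm m = ⊛-cancelʳ (F m) _ Q^m+2 (1-t^-constant (m + 2)) λ n → begin
    (F m ⊛ Q ⊛^ (m + 2)) n
      ≡⟨ *-congˡ {F m} (⊛^-+ Q m 2) n ⟩
    (F m ⊛ (Q ⊛^ m ⊛ Q ⊛^ 2)) n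
      ≡⟨ solve 4 (λ f g x y → f :* g :* (x :* y) := f :* x :* (g :* y))
           (λ _ → refl) (φ ⊛^ m) G (Q ⊛^ m) (Q ⊛^ 2) n ⟩
    (φ ⊛^ m ⊛ Q ⊛^ m ⊛ (G ⊛ Q ⊛^ 2)) n
      ≡⟨ ⊛-cong (λ k → trans (sym (⊛^-distrib-⊛ φ Q m k)) (⊛^-cong m φQ≗P k)) G-Q² n ⟩
    (P ⊛^ m ⊛ W) n
      ≡⟨ *-congʳ {W} (⊘-correct (P ⊛^ m) Q^m+2 (1-t^-constant (m + 2))) n ⟨
    ((P ⊛^ m ⊘ Q^m+2) ⊛ Q^m+2 ⊛ W) n
      ≡⟨ solve 3 (λ x y z → x :* y :* z := x :* z :* y)
           (λ _ → refl) (P ⊛^ m ⊘ Q^m+2) Q^m+2 W n ⟩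
    ((P ⊛^ m ⊘ Q^m+2) ⊛ W ⊛ Q^m+2) n ∎
    where
    Q^m+2 = Q ⊛^ (m + 2)

  F-0 : ∀ m → F m 0 ≡ 1ℤ
  F-0 zero    = refl
  F-0 (suc m) = trans (cong (ℤ._* 1ℤ) (ℤ.*-identityˡ ((φ ⊛^ m) 0))) (F-0 m)

  F-diagonal : ∀ n → F n (suc n) ≡ 0ℤ
  F-diagonal = lagrange φ

  F-suc : ∀ m → F (suc m) ⊖ t ⊛ F (suc m) ≗ F m ⊖ t ⊛^ r ⊛ F m
  F-suc m n = begin
    (F (suc m) ⊖ t ⊛ F (suc m)) n
      ≡⟨ solve 4 (λ f x g t → f :* x :* g :- t :* (f :* x :* g) := f :* (con 1ℤ :- t) :* (x :* g))
           (λ _ → refl) φ (φ ⊛^ m) G t n ⟩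
    (φ ⊛ Q ⊛ F m) n
      ≡⟨ *-congʳ {F m} φQ≗P n ⟩
    (P ⊛ F m) n
      ≡⟨ solve 2 (λ x f → (con 1ℤ :- x) :* f := f :- x :* f) (λ _ → refl) (t ⊛^ r) (F m) n ⟩
    (F m ⊖ t ⊛^ r ⊛ F m) n ∎

  F-recurrence : ∀ m n →
    F (suc m) (suc n) ≡ F (suc m) n ℤ.+ F m (suc n) ℤ.- (t ⊛^ r′ ⊛ F m) n
  F-recurrence m n = begin
    F (suc m) (suc n)
      ≡⟨ split (F (suc m) (suc n)) _ ⟩
    (F (suc m) ⊖ t ⊛ F (suc m)) (suc n) ℤ.+ (t ⊛ F (suc m)) (suc n)
      ≡⟨ cong₂ ℤ._+_ (F-suc m (suc n)) (t-⊛ (F (suc m)) n) ⟩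
    F m (suc n) ℤ.- (t ⊛^ r ⊛ F m) (suc n) ℤ.+ F (suc m) n
      ≡⟨ cong (λ z → F m (suc n) ℤ.- z ℤ.+ F (suc m) n)
           (trans (⊛-assoc t (t ⊛^ r′) (F m) (suc n)) (t-⊛ (t ⊛^ r′ ⊛ F m) n)) ⟩
    F m (suc n) ℤ.- (t ⊛^ r′ ⊛ F m) n ℤ.+ F (suc m) n
      ≡⟨ reorder (F m (suc n)) ((t ⊛^ r′ ⊛ F m) n) (F (suc m) n) ⟩
    F (suc m) n ℤ.+ F m (suc n) ℤ.- (t ⊛^ r′ ⊛ F m) n ∎
    where
    split : ∀ a b → a ≡ a ℤ.- b ℤ.+ b
    split = solve-∀
    reorder : ∀ a b c → a ℤ.- b ℤ.+ c ≡ c ℤ.+ a ℤ.- b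
    reorder = solve-∀

-- Paths and their last step

xEnd-∷ʳ↑ : ∀ p → xEnd (p ∷ʳ ↑) ≡ xEnd p
xEnd-∷ʳ↑ []      = refl
xEnd-∷ʳ↑ (↑ ∷ p) = xEnd-∷ʳ↑ p
xEnd-∷ʳ↑ (⇒ ∷ p) = cong suc (xEnd-∷ʳ↑ p)

xEnd-∷ʳ⇒ : ∀ p → xEnd (p ∷ʳ ⇒) ≡ suc (xEnd p)
xEnd-∷ʳ⇒ []      = refl
xEnd-∷ʳ⇒ (↑ ∷ p) = xEnd-∷ʳ⇒ p
xEnd-∷ʳ⇒ (⇒ ∷ p) = cong suc (xEnd-∷ʳ⇒ p)

yEnd-∷ʳ↑ : ∀ p → yEnd (p ∷ʳ ↑) ≡ suc (yEnd p)
yEnd-∷ʳ↑ []      = refl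
yEnd-∷ʳ↑ (↑ ∷ p) = cong suc (yEnd-∷ʳ↑ p)
yEnd-∷ʳ↑ (⇒ ∷ p) = yEnd-∷ʳ↑ p

yEnd-∷ʳ⇒ : ∀ p → yEnd (p ∷ʳ ⇒) ≡ yEnd p
yEnd-∷ʳ⇒ []      = refl
yEnd-∷ʳ⇒ (↑ ∷ p) = cong suc (yEnd-∷ʳ⇒ p)
yEnd-∷ʳ⇒ (⇒ ∷ p) = yEnd-∷ʳ⇒ p

yEnd-replicate-⇒ : ∀ k → yEnd (replicate k ⇒) ≡ 0
yEnd-replicate-⇒ zero    = refl
yEnd-replicate-⇒ (suc k) = yEnd-replicate-⇒ k

length≡xEnd+yEnd : ∀ p → length p ≡ xEnd p + yEnd p
length≡xEnd+yEnd []      = refl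
length≡xEnd+yEnd (↑ ∷ p) =
  trans (cong suc (length≡xEnd+yEnd p)) (sym (ℕ.+-suc (xEnd p) (yEnd p)))
length≡xEnd+yEnd (⇒ ∷ p) = cong suc (length≡xEnd+yEnd p)

inits-∷ʳ : ∀ (p : Path) a → inits (p ∷ʳ a) ≡ inits p ∷ʳ (p ∷ʳ a)
inits-∷ʳ []      a = refl
inits-∷ʳ (b ∷ p) a = cong ([] ∷_)
  (trans (cong (map (b ∷_)) (inits-∷ʳ p a)) (map-++ (b ∷_) (inits p) _))

aboveDiagonal-∷ʳ⁺ : ∀ p a → AboveDiagonal p → xEnd (p ∷ʳ a) ≤ yEnd (p ∷ʳ a) →
  AboveDiagonal (p ∷ʳ a)
aboveDiagonal-∷ʳ⁺ p a above x≤y = subst (All _) (sym (inits-∷ʳ p a)) (∷ʳ⁺ above x≤y)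

aboveDiagonal-∷ʳ⁻ : ∀ p a → AboveDiagonal (p ∷ʳ a) →
  AboveDiagonal p × xEnd (p ∷ʳ a) ≤ yEnd (p ∷ʳ a)
aboveDiagonal-∷ʳ⁻ p a above = ∷ʳ⁻ (subst (All _) (inits-∷ʳ p a) above)

aboveDiagonal-end : ∀ p → AboveDiagonal p → xEnd p ≤ yEnd p
aboveDiagonal-end p above with initLast p
... | []      = z≤n
... | q ∷ʳ′ a = proj₂ (aboveDiagonal-∷ʳ⁻ q a above)

replicate-∷ʳ : ∀ k → replicate k ⇒ ∷ʳ ⇒ ≡ replicate (suc k) ⇒
replicate-∷ʳ zero    = refl
replicate-∷ʳ (suc k) = cong (⇒ ∷_) (replicate-∷ʳ k)

++-replicate-∷ʳ : ∀ (u : Path) k → u ++ replicate (suc k) ⇒ ≡ (u ++ replicate k ⇒) ∷ʳ ⇒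
++-replicate-∷ʳ u k =
  trans (cong (u ++_) (sym (replicate-∷ʳ k))) (sym (++-assoc u (replicate k ⇒) (⇒ ∷ [])))

∷ʳ≡++-replicate : ∀ p a u k → p ∷ʳ a ≡ u ++ replicate (suc k) ⇒ → p ≡ u ++ replicate k ⇒ × a ≡ ⇒
∷ʳ≡++-replicate p a u k eq = ∷ʳ-injective p _ (trans eq (++-replicate-∷ʳ u k))

-- A path contains r consecutive ⇒ steps; the negation of Avoids.
Contains : ℕ → Path → Set
Contains r p = Infix _≡_ (replicate r ⇒) p

contains-++ : ∀ r u v → Contains r (u ++ replicate r ⇒ ++ v)
contains-++ r u v = fromView (MkView u (Pointwise.refl refl) v)

contains-suffix : ∀ r u → Contains r (u ++ replicate r ⇒)
contains-suffix r u = subst (λ v → Contains r (u ++ v)) (++-identityʳ _) (contains-++ r u [])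

-- A run of r ⇒ steps in p ∷ʳ a that does not lie in p is a suffix of p ∷ʳ a.
contains-∷ʳ⁻ : ∀ r p a → Contains r (p ∷ʳ a) →
  Contains r p ⊎ (∃[ u ] p ∷ʳ a ≡ u ++ replicate r ⇒)
contains-∷ʳ⁻ r p a inf = go (toView inf) refl
  where
  go : ∀ {q} → View _≡_ (replicate r ⇒) q → q ≡ p ∷ʳ a →
       Contains r p ⊎ (∃[ u ] p ∷ʳ a ≡ u ++ replicate r ⇒)
  go (MkView u pw v) eq with refl ← Pointwise-≡⇒≡ pw | initLast v
  ... | []      = inj₂ (u , trans (sym eq) (cong (u ++_) (++-identityʳ _)))
  ... | w ∷ʳ′ b = inj₁ (subst (Contains r) (∷ʳ-injectiveˡ _ p (trans assoc eq)) (contains-++ r u w))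
    where
    assoc : (u ++ replicate r ⇒ ++ w) ∷ʳ b ≡ u ++ replicate r ⇒ ++ (w ∷ʳ b)
    assoc = trans (++-assoc u _ _) (cong (u ++_) (++-assoc (replicate r ⇒) w _))

avoids-∷ʳ⁻ : ∀ r p a → Avoids r (p ∷ʳ a) → Avoids r p
avoids-∷ʳ⁻ r p a avoids inf = avoids (inf ⁱ++ (a ∷ []))

-- The extension of q by one ↑ step and then j ⇒ steps.
peak : Path → ℕ → Path
peak q j = q ∷ʳ ↑ ++ replicate j ⇒

peak-suc : ∀ q j → peak q (suc j) ≡ peak q j ∷ʳ ⇒
peak-suc q j = ++-replicate-∷ʳ (q ∷ʳ ↑) j

peak-zero : ∀ q → peak q 0 ≡ q ∷ʳ ↑
peak-zero q = ++-identityʳ (q ∷ʳ ↑)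

peak-injective : ∀ j {p q} → peak p j ≡ peak q j → p ≡ q
peak-injective j {p} {q} eq = ∷ʳ-injectiveˡ p q (++-cancelʳ (replicate j ⇒) _ _ eq)

-- The ↑ step before the last j steps of peak q j stops its final ⇒ run.
peak-short : ∀ {j r} q u → j < r → peak q j ≢ u ++ replicate r ⇒
peak-short {zero}  {suc r} q u _         eq
  with () ← proj₂ (∷ʳ≡++-replicate q ↑ u r (trans (sym (peak-zero q)) eq))
peak-short {suc j} {suc r} q u (s≤s j<r) eq =
  peak-short q u j<r (proj₁ (∷ʳ≡++-replicate (peak q j) ⇒ u r (trans (sym (peak-suc q j)) eq)))

avoids-peak : ∀ {r} q j → j < r → Avoids r q → Avoids r (peak q j)
avoids-peak {r} q zero    0<r avoids inf
  with contains-∷ʳ⁻ r q ↑ (subst (Contains r) (peak-zero q) inf)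
... | inj₁ inf′     = avoids inf′
... | inj₂ (u , eq) = peak-short q u 0<r (trans (peak-zero q) eq)
avoids-peak {r} q (suc j) j<r avoids inf
  with contains-∷ʳ⁻ r (peak q j) ⇒ (subst (Contains r) (peak-suc q j) inf)
... | inj₁ inf′     = avoids-peak q j (ℕ.<-trans (ℕ.n<1+n j) j<r) avoids inf′
... | inj₂ (u , eq) = peak-short q u j<r (trans (peak-suc q j) eq)

-- Ballot paths and their last step

ballot-∷ʳ↑⁺ : ∀ {r n m p} → 0 < r → IsBallotPath r n m p → IsBallotPath r n (suc m) (p ∷ʳ ↑)
ballot-∷ʳ↑⁺ {r} {n} {m} {p} 0<r ((refl , refl) , above , avoids) =
  (xEnd-∷ʳ↑ p , yEnd-∷ʳ↑ p) ,
  aboveDiagonal-∷ʳ⁺ p ↑ above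
    (subst₂ _≤_ (sym (xEnd-∷ʳ↑ p)) (sym (yEnd-∷ʳ↑ p))
      (ℕ.m≤n⇒m≤1+n (aboveDiagonal-end p above))) ,
  subst (Avoids r) (peak-zero p) (avoids-peak p 0 0<r avoids)

ballot-∷ʳ↑⁻ : ∀ {r n m p} → IsBallotPath r n (suc m) (p ∷ʳ ↑) → IsBallotPath r n m p
ballot-∷ʳ↑⁻ {r} {p = p} ((x≡n , y≡m) , above , avoids) =
  (trans (sym (xEnd-∷ʳ↑ p)) x≡n , ℕ.suc-injective (trans (sym (yEnd-∷ʳ↑ p)) y≡m)) ,
  proj₁ (aboveDiagonal-∷ʳ⁻ p ↑ above) , avoids-∷ʳ⁻ r p ↑ avoids

ballot-∷ʳ⇒⁺ : ∀ {r n m p} → n < m → Avoids r (p ∷ʳ ⇒) → IsBallotPath r n m p →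
  IsBallotPath r (suc n) m (p ∷ʳ ⇒)
ballot-∷ʳ⇒⁺ {p = p} n<m avoids ((refl , refl) , above , _) =
  (xEnd-∷ʳ⇒ p , yEnd-∷ʳ⇒ p) ,
  aboveDiagonal-∷ʳ⁺ p ⇒ above (subst₂ _≤_ (sym (xEnd-∷ʳ⇒ p)) (sym (yEnd-∷ʳ⇒ p)) n<m) ,
  avoids

ballot-∷ʳ⇒⁻ : ∀ {r n m p} → IsBallotPath r n m (p ∷ʳ ⇒) → ∃[ k ] (n ≡ suc k × IsBallotPath r k m p)
ballot-∷ʳ⇒⁻ {r} {p = p} ((x≡n , y≡m) , above , avoids) =
  xEnd p , trans (sym x≡n) (xEnd-∷ʳ⇒ p) ,
  (refl , trans (sym (yEnd-∷ʳ⇒ p)) y≡m) ,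
  proj₁ (aboveDiagonal-∷ʳ⁻ p ⇒ above) , avoids-∷ʳ⁻ r p ⇒ avoids

ballot-peak⁺ : ∀ {r n m q} j → j < r → j + n ≤ suc m → IsBallotPath r n m q →
  IsBallotPath r (j + n) (suc m) (peak q j)
ballot-peak⁺ {r} {n} {m} {q} zero 0<r _ ballot =
  subst (IsBallotPath r n (suc m)) (sym (peak-zero q)) (ballot-∷ʳ↑⁺ 0<r ballot)
ballot-peak⁺ {r} {n} {m} {q} (suc j) j<r j+n<m ballot@(_ , _ , avoids) =
  subst (IsBallotPath r (suc j + n) (suc m)) (sym (peak-suc q j))
    (ballot-∷ʳ⇒⁺ j+n<m (subst (Avoids r) (peak-suc q j) (avoids-peak q (suc j) j<r avoids))
      (ballot-peak⁺ j (ℕ.<-trans (ℕ.n<1+n j) j<r) (ℕ.<⇒≤ j+n<m) ballot))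

ballot-peak⁻ : ∀ {r n m q} j → IsBallotPath r n (suc m) (peak q j) →
  ∃[ k ] (j + k ≡ n × IsBallotPath r k m q)
ballot-peak⁻ {r} {n} {m} {q} zero ballot =
  n , refl , ballot-∷ʳ↑⁻ (subst (IsBallotPath r n (suc m)) (peak-zero q) ballot)
ballot-peak⁻ {r} {n} {m} {q} (suc j) ballot
  with n′ , refl , ballot′ ← ballot-∷ʳ⇒⁻ (subst (IsBallotPath r n (suc m)) (peak-suc q j) ballot)
  with k , j+k≡n′ , ballot″ ← ballot-peak⁻ j ballot′ = k , cong suc j+k≡n′ , ballot″

-- Enumerations of ballot paths

paths-complete : ∀ p → p ∈ paths (length p)
paths-complete []      = here refl
paths-complete (↑ ∷ p) = ∈-++⁺ˡ (∈-map⁺ (↑ ∷_) (paths-complete p))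
paths-complete (⇒ ∷ p) = ∈-++⁺ʳ (map (↑ ∷_) (paths (length p))) (∈-map⁺ (⇒ ∷_) (paths-complete p))

map-disjoint : ∀ {A B : Set} {f g : A → B} {xs ys} →
  (∀ x y → f x ≢ g y) → Disjoint (map f xs) (map g ys)
map-disjoint {f = f} {g} f≢g (v∈f , v∈g)
  with x , _ , v≡fx ← ∈-map⁻ f v∈f | y , _ , v≡gy ← ∈-map⁻ g v∈g = f≢g x y (trans (sym v≡fx) v≡gy)

paths-unique : ∀ l → Unique (paths l)
paths-unique zero    = [] AllPairs.∷ AllPairs.[]
paths-unique (suc l) = Unique.++⁺
  (Unique.map⁺ ∷-injectiveʳ (paths-unique l)) (Unique.map⁺ ∷-injectiveʳ (paths-unique l))
  (map-disjoint λ _ _ ())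

same-members⇒same-length : ∀ {A : Set} {xs ys : List A} → Unique xs → Unique ys →
  (∀ {z} → z ∈ xs → z ∈ ys) → (∀ {z} → z ∈ ys → z ∈ xs) → length xs ≡ length ys
same-members⇒same-length xs! ys! xs⊆ys ys⊆xs =
  ↭-length (∼bag⇒↭ (unique∧set⇒bag xs! ys! (mk⇔ xs⊆ys ys⊆xs)))

-- The list of which #ballotPaths is the length.
ballotPaths : (r n m : ℕ) → List Path
ballotPaths r n m = filter (isBallotPath? r n m) (paths (n + m))

∈-ballotPaths⁺ : ∀ {r n m p} → IsBallotPath r n m p → p ∈ ballotPaths r n m
∈-ballotPaths⁺ {r} {n} {m} {p} ballot@((refl , refl) , _) = ∈-filter⁺ (isBallotPath? r n m)
  (subst (λ l → p ∈ paths l) (length≡xEnd+yEnd p) (paths-complete p)) ballot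

∈-ballotPaths⁻ : ∀ {r n m p} → p ∈ ballotPaths r n m → IsBallotPath r n m p
∈-ballotPaths⁻ {r} {n} {m} p∈ = proj₂ (∈-filter⁻ (isBallotPath? r n m) {xs = paths (n + m)} p∈)

ballotPaths-unique : ∀ r n m → Unique (ballotPaths r n m)
ballotPaths-unique r n m = Unique.filter⁺ (isBallotPath? r n m) (paths-unique (n + m))

-- The ballot paths to (n - j , m), none if n < j; the list that sLagged counts.
laggedPaths : (r n j m : ℕ) → List Path
laggedPaths r n       zero    m = ballotPaths r n m
laggedPaths r zero    (suc j) m = []
laggedPaths r (suc n) (suc j) m = laggedPaths r n j m

∈-laggedPaths⁺ : ∀ {r m p} n j → IsBallotPath r n m p → p ∈ laggedPaths r (j + n) j m
∈-laggedPaths⁺ n zero    ballot = ∈-ballotPaths⁺ ballot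
∈-laggedPaths⁺ n (suc j) ballot = ∈-laggedPaths⁺ n j ballot

∈-laggedPaths⁻ : ∀ {r m p} n j → p ∈ laggedPaths r n j m →
  ∃[ k ] (j + k ≡ n × IsBallotPath r k m p)
∈-laggedPaths⁻ n       zero    p∈ = n , refl , ∈-ballotPaths⁻ p∈
∈-laggedPaths⁻ (suc n) (suc j) p∈ with k , j+k≡n , ballot ← ∈-laggedPaths⁻ n j p∈ =
  k , cong suc j+k≡n , ballot

laggedPaths-unique : ∀ r n j m → Unique (laggedPaths r n j m)
laggedPaths-unique r n       zero    m = ballotPaths-unique r n m
laggedPaths-unique r zero    (suc j) m = AllPairs.[]
laggedPaths-unique r (suc n) (suc j) m = laggedPaths-unique r n j m

-- Counts of ballot paths

module _ (r′ : ℕ) where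

  private
    r : ℕ
    r = suc r′

  module _ (n m : ℕ) (n≤m : n ≤ m) where

    -- Two lists of the paths to (n+1 , m+1) whose removal of the last step leaves
    -- a ballot path.  The first sorts them by the last step.  In the second, those
    -- that are not ballot paths themselves end in the forbidden run, which is
    -- preceded by an ↑ step leaving a ballot path to (n+1-r , m).
    byLastStep extended : List Path
    byLastStep = map (_∷ʳ ⇒) (ballotPaths r n (suc m)) ++ map (_∷ʳ ↑) (ballotPaths r (suc n) m)
    extended   = ballotPaths r (suc n) (suc m) ++ map (λ q → peak q r) (laggedPaths r n r′ m)

    byLastStep⊆extended : ∀ {p} → p ∈ byLastStep → p ∈ extended
    byLastStep⊆extended p∈ with ∈-++⁻ (map (_∷ʳ ⇒) (ballotPaths r n (suc m))) p∈
    ... | inj₂ p∈↑ with q , q∈ , refl ← ∈-map⁻ (_∷ʳ ↑) p∈↑ =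
      ∈-++⁺ˡ (∈-ballotPaths⁺ {r} {suc n} {suc m}
        (ballot-∷ʳ↑⁺ (s≤s z≤n) (∈-ballotPaths⁻ {r} {suc n} {m} q∈)))
    ... | inj₁ p∈⇒ with q , q∈ , refl ← ∈-map⁻ (_∷ʳ ⇒) p∈⇒ = right q (∈-ballotPaths⁻ q∈)
      where
      right : ∀ q → IsBallotPath r n (suc m) q → q ∷ʳ ⇒ ∈ extended
      right q ballot@((_ , y≡m) , _ , avoids) with infix? _≟_ (replicate r ⇒) (q ∷ʳ ⇒)
      ... | no ¬inf = ∈-++⁺ˡ (∈-ballotPaths⁺ (ballot-∷ʳ⇒⁺ (s≤s n≤m) ¬inf ballot))
      ... | yes inf with contains-∷ʳ⁻ r q ⇒ inf
      ...   | inj₁ inf′ = contradiction inf′ avoids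
      ...   | inj₂ (u , eq) with refl , _ ← ∷ʳ≡++-replicate q ⇒ u r′ eq | initLast u
      -- q is a run of ⇒ steps alone, which ends at height 0.
      ...     | [] with () ← trans (sym y≡m) (yEnd-replicate-⇒ r′)
      -- The run of r - 1 steps ⇒ that ends q is preceded by another ⇒.
      ...     | v ∷ʳ′ ⇒ = contradiction
                (subst (Contains r) (sym (++-assoc v (⇒ ∷ []) (replicate r′ ⇒))) (contains-suffix r v))
                avoids
      ...     | v ∷ʳ′ ↑ with k , refl , ballot′ ← ballot-peak⁻ r′ ballot =
        ∈-++⁺ʳ (ballotPaths r (suc n) (suc m))
          (subst (_∈ map (λ q → peak q r) (laggedPaths r n r′ m)) (peak-suc v r′)
            (∈-map⁺ (λ q → peak q r) (∈-laggedPaths⁺ k r′ ballot′)))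

    extended⊆byLastStep : ∀ {p} → p ∈ extended → p ∈ byLastStep
    extended⊆byLastStep {p} p∈ with ∈-++⁻ (ballotPaths r (suc n) (suc m)) p∈
    ... | inj₂ p∈peak
      with q , q∈ , refl ← ∈-map⁻ (λ q → peak q r) p∈peak
      with k , refl , ballot ← ∈-laggedPaths⁻ n r′ q∈ =
      ∈-++⁺ˡ (subst (_∈ map (_∷ʳ ⇒) (ballotPaths r n (suc m))) (sym (peak-suc q r′))
        (∈-map⁺ (_∷ʳ ⇒) (∈-ballotPaths⁺
          (ballot-peak⁺ r′ ℕ.≤-refl (ℕ.m≤n⇒m≤1+n n≤m) ballot))))
    ... | inj₁ p∈ballot with ballot ← ∈-ballotPaths⁻ {r} {suc n} {suc m} p∈ballot | initLast p
    ...   | [] with () ← proj₁ (proj₁ ballot)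
    ...   | q ∷ʳ′ ⇒ with k , refl , ballot′ ← ballot-∷ʳ⇒⁻ ballot =
      ∈-++⁺ˡ (∈-map⁺ (_∷ʳ ⇒) (∈-ballotPaths⁺ ballot′))
    ...   | q ∷ʳ′ ↑ = ∈-++⁺ʳ (map (_∷ʳ ⇒) (ballotPaths r n (suc m)))
      (∈-map⁺ (_∷ʳ ↑) (∈-ballotPaths⁺ (ballot-∷ʳ↑⁻ ballot)))

    byLastStep-unique : Unique byLastStep
    byLastStep-unique = Unique.++⁺
      (Unique.map⁺ (∷ʳ-injectiveˡ _ _) (ballotPaths-unique r n (suc m)))
      (Unique.map⁺ (∷ʳ-injectiveˡ _ _) (ballotPaths-unique r (suc n) m))
      (map-disjoint ⇒≢↑)
      where
      ⇒≢↑ : ∀ (p q : Path) → p ∷ʳ ⇒ ≢ q ∷ʳ ↑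
      ⇒≢↑ p q eq with () ← ∷ʳ-injectiveʳ p q eq

    extended-unique : Unique extended
    extended-unique = Unique.++⁺
      (ballotPaths-unique r (suc n) (suc m))
      (Unique.map⁺ (peak-injective r) (laggedPaths-unique r n r′ m))
      disjoint
      where
      disjoint : Disjoint (ballotPaths r (suc n) (suc m))
                          (map (λ q → peak q r) (laggedPaths r n r′ m))
      disjoint (p∈ballot , p∈peak) with q , _ , refl ← ∈-map⁻ (λ q → peak q r) p∈peak =
        proj₂ (proj₂ (∈-ballotPaths⁻ {r} {suc n} {suc m} p∈ballot)) (contains-suffix r (q ∷ʳ ↑))

    #ballotPaths-recurrence :
      #ballotPaths r n (suc m) + #ballotPaths r (suc n) m ≡
      #ballotPaths r (suc n) (suc m) + length (laggedPaths r n r′ m)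
    #ballotPaths-recurrence = begin
      #ballotPaths r n (suc m) + #ballotPaths r (suc n) m
        ≡⟨ cong₂ _+_ (length-map (_∷ʳ ⇒) (ballotPaths r n (suc m)))
                     (length-map (_∷ʳ ↑) (ballotPaths r (suc n) m)) ⟨
      length (map (_∷ʳ ⇒) (ballotPaths r n (suc m))) + length (map (_∷ʳ ↑) (ballotPaths r (suc n) m))
        ≡⟨ length-++ (map (_∷ʳ ⇒) (ballotPaths r n (suc m))) ⟨
      length byLastStep
        ≡⟨ same-members⇒same-length byLastStep-unique extended-unique
             byLastStep⊆extended extended⊆byLastStep ⟩
      length extended
        ≡⟨ length-++ (ballotPaths r (suc n) (suc m)) ⟩
      #ballotPaths r (suc n) (suc m) + length (map (λ q → peak q r) (laggedPaths r n r′ m))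
        ≡⟨ cong (_+_ (#ballotPaths r (suc n) (suc m)))
             (length-map (λ q → peak q r) (laggedPaths r n r′ m)) ⟩
      #ballotPaths r (suc n) (suc m) + length (laggedPaths r n r′ m) ∎

  #ballotPaths-zero : ∀ m → #ballotPaths r 0 m ≡ 1
  #ballotPaths-zero zero    = refl
  #ballotPaths-zero (suc m) = begin
    #ballotPaths r 0 (suc m)
      ≡⟨ same-members⇒same-length (ballotPaths-unique r 0 (suc m))
           (Unique.map⁺ (∷ʳ-injectiveˡ _ _) (ballotPaths-unique r 0 m)) to from ⟩
    length (map (_∷ʳ ↑) (ballotPaths r 0 m))
      ≡⟨ length-map (_∷ʳ ↑) (ballotPaths r 0 m) ⟩
    #ballotPaths r 0 m
      ≡⟨ #ballotPaths-zero m ⟩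
    1 ∎
    where
    to : ∀ {p} → p ∈ ballotPaths r 0 (suc m) → p ∈ map (_∷ʳ ↑) (ballotPaths r 0 m)
    to {p} p∈ with ballot ← ∈-ballotPaths⁻ {r} {0} {suc m} p∈ | initLast p
    ... | [] with () ← proj₂ (proj₁ ballot)
    ... | q ∷ʳ′ ⇒ with () ← proj₁ (proj₂ (ballot-∷ʳ⇒⁻ ballot))
    ... | q ∷ʳ′ ↑ = ∈-map⁺ (_∷ʳ ↑) (∈-ballotPaths⁺ (ballot-∷ʳ↑⁻ ballot))
    from : ∀ {p} → p ∈ map (_∷ʳ ↑) (ballotPaths r 0 m) → p ∈ ballotPaths r 0 (suc m)
    from p∈ with q , q∈ , refl ← ∈-map⁻ (_∷ʳ ↑) p∈ =
      ∈-ballotPaths⁺ {r} {0} {suc m} (ballot-∷ʳ↑⁺ (s≤s z≤n) (∈-ballotPaths⁻ {r} {0} {m} q∈))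

  #ballotPaths-below : ∀ {n m} → m < n → #ballotPaths r n m ≡ 0
  #ballotPaths-below {n} {m} m<n =
    cong length (filter-none (isBallotPath? r n m) (All.universal notBallot (paths (n + m))))
    where
    notBallot : ∀ p → ¬ IsBallotPath r n m p
    notBallot p ((refl , refl) , above , _) = ℕ.<⇒≱ m<n (aboveDiagonal-end p above)

  -- The recurrence for the extended numbers

  diagonal-offset : ∀ n → + n ℤ.- + suc n ≡ -[1+ 0 ]
  diagonal-offset n = cancel (+ n)
    where
    cancel : ∀ a → a ℤ.- (1ℤ ℤ.+ a) ≡ -[1+ 0 ]
    cancel = solve-∀

  s-diagonal : ∀ n → s r (suc n) (+ n) ≡ 0ℤ
  s-diagonal n = cong (sFromDiagonal r n) (diagonal-offset n)

  -- The range includes m = n - 1, just below the diagonal, where both sides are 0.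
  s≡#ballotPaths : ∀ n m → n ≤ suc m → s r n (+ m) ≡ + #ballotPaths r n m
  s≡#ballotPaths zero    m _   = cong +_ (sym (#ballotPaths-zero m))
  s≡#ballotPaths (suc n) m n≤m with ℕ.m≤n⇒m<n∨m≡n (s≤s⁻¹ n≤m)
  ... | inj₂ refl = trans (s-diagonal n) (cong +_ (sym (#ballotPaths-below (ℕ.n<1+n n))))
  ... | inj₁ n<m with d , refl ← ℕ.m≤n⇒∃[o]m+o≡n n<m =
    cong (sFromDiagonal r n) (cancel (+ suc n) (+ d))
    where
    cancel : ∀ a b → a ℤ.+ b ℤ.- a ≡ b
    cancel = solve-∀

  sLagged≡#laggedPaths : ∀ n j m → n ≤ m → sLagged r n j (+ m) ≡ + length (laggedPaths r n j m)
  sLagged≡#laggedPaths n       zero    m n≤m = s≡#ballotPaths n m (ℕ.m≤n⇒m≤1+n n≤m)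
  sLagged≡#laggedPaths zero    (suc j) m n≤m = refl
  sLagged≡#laggedPaths (suc n) (suc j) m n≤m = sLagged≡#laggedPaths n j m (ℕ.<⇒≤ n≤m)

  -- Weakly above the diagonal this is the recurrence for path counts; below it,
  -- it is the equation that defines s_n(m-1).
  s-recurrence : ∀ n m →
    s r (suc n) (+ suc m) ≡ s r n (+ suc m) ℤ.+ s r (suc n) (+ m) ℤ.- sLagged r n r′ (+ m)
  s-recurrence n m with ℕ.≤-<-connex n m
  ... | inj₁ n≤m = begin
    s r (suc n) (+ suc m)
      ≡⟨ s≡#ballotPaths (suc n) (suc m) (s≤s (ℕ.m≤n⇒m≤1+n n≤m)) ⟩
    + #ballotPaths r (suc n) (suc m)
      ≡⟨ cancel (+ #ballotPaths r (suc n) (suc m)) (+ length (laggedPaths r n r′ m)) ⟩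
    + (#ballotPaths r (suc n) (suc m) + length (laggedPaths r n r′ m))
      ℤ.- + length (laggedPaths r n r′ m)
      ≡⟨ cong (λ a → + a ℤ.- + length (laggedPaths r n r′ m)) (#ballotPaths-recurrence n m n≤m) ⟨
    + #ballotPaths r n (suc m) ℤ.+ + #ballotPaths r (suc n) m ℤ.- + length (laggedPaths r n r′ m)
      ≡⟨ cong₂ ℤ._-_
           (cong₂ ℤ._+_ (s≡#ballotPaths n (suc m) (ℕ.m≤n⇒m≤1+n (ℕ.m≤n⇒m≤1+n n≤m)))
                        (s≡#ballotPaths (suc n) m (s≤s n≤m)))
           (sLagged≡#laggedPaths n r′ m n≤m) ⟨
    s r n (+ suc m) ℤ.+ s r (suc n) (+ m) ℤ.- sLagged r n r′ (+ m) ∎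
    where
    cancel : ∀ a b → a ≡ a ℤ.+ b ℤ.- b
    cancel = solve-∀
  -- Here n = m + 1 + k, so (n+1 , m+1) lies k + 1 below the diagonal.
  ... | inj₂ m<n with k , refl ← ℕ.m≤n⇒∃[o]m+o≡n m<n = begin
    s r (suc n) (+ suc m)
      ≡⟨ cong (sFromDiagonal r n) (offset (+ m) (+ k)) ⟩
    sFromDiagonal r n -[1+ k ]
      ≡⟨ solveForPrevious (sFromDiagonal r n -[1+ k ]) (s r n M) (sLagged r n r′ (M ℤ.- 1ℤ)) ⟩
    s r n M ℤ.+ sFromDiagonal r n -[1+ suc k ] ℤ.- sLagged r n r′ (M ℤ.- 1ℤ)
      ≡⟨ cong₂ (λ a b → s r n a ℤ.+ sFromDiagonal r n -[1+ suc k ] ℤ.- sLagged r n r′ b)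
           (M≡ (+ m) (+ k)) (M-1≡ (+ m) (+ k)) ⟩
    s r n (+ suc m) ℤ.+ sFromDiagonal r n -[1+ suc k ] ℤ.- sLagged r n r′ (+ m)
      ≡⟨ cong (λ d → s r n (+ suc m) ℤ.+ sFromDiagonal r n d ℤ.- sLagged r n r′ (+ m))
           (offset′ (+ m) (+ k)) ⟨
    s r n (+ suc m) ℤ.+ s r (suc n) (+ m) ℤ.- sLagged r n r′ (+ m) ∎
    where
    M = + n ℤ.- + k
    solveForPrevious : ∀ x a b → x ≡ a ℤ.+ (x ℤ.- a ℤ.+ b) ℤ.- b
    solveForPrevious = solve-∀
    offset : ∀ m k → (1ℤ ℤ.+ m) ℤ.- (1ℤ ℤ.+ (1ℤ ℤ.+ (m ℤ.+ k))) ≡ ℤ.- (1ℤ ℤ.+ k)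
    offset = solve-∀
    offset′ : ∀ m k → m ℤ.- (1ℤ ℤ.+ (1ℤ ℤ.+ (m ℤ.+ k))) ≡ ℤ.- (1ℤ ℤ.+ (1ℤ ℤ.+ k))
    offset′ = solve-∀
    M≡ : ∀ m k → 1ℤ ℤ.+ (m ℤ.+ k) ℤ.- k ≡ 1ℤ ℤ.+ m
    M≡ = solve-∀
    M-1≡ : ∀ m k → 1ℤ ℤ.+ (m ℤ.+ k) ℤ.- k ℤ.- 1ℤ ≡ m
    M-1≡ = solve-∀

-- The generating function

-- The lag in the recurrence is multiplication by a power of t.
sLagged≡coefficient : ∀ r f m n j → (∀ k → k ≤ n → s r k (+ m) ≡ f k) →
  sLagged r n j (+ m) ≡ (t ⊛^ j ⊛ f) n
sLagged≡coefficient r f m n zero s≡f =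
  trans (s≡f n ℕ.≤-refl) (sym (⊛-identityˡ f n))
sLagged≡coefficient r f m zero (suc j) s≡f = refl
sLagged≡coefficient r f m (suc n) (suc j) s≡f = begin
  sLagged r n j (+ m)
    ≡⟨ sLagged≡coefficient r f m n j (λ k k≤n → s≡f k (ℕ.m≤n⇒m≤1+n k≤n)) ⟩
  (t ⊛^ j ⊛ f) n
    ≡⟨ t-⊛ (t ⊛^ j ⊛ f) n ⟨
  (t ⊛ (t ⊛^ j ⊛ f)) (suc n)
    ≡⟨ ⊛-assoc t (t ⊛^ j) f (suc n) ⟨
  (t ⊛^ suc j ⊛ f) (suc n) ∎

-- Two solutions of one first-order recurrence that agree somewhere agree
-- everywhere.
agreeAt⇒agree : ∀ (a b x y : ℕ → ℤ) →
  (∀ m → a (suc m) ≡ x m ℤ.+ a m ℤ.- y m) →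
  (∀ m → b (suc m) ≡ x m ℤ.+ b m ℤ.- y m) →
  ∀ n → a n ≡ b n → a ≗ b
agreeAt⇒agree a b x y a-suc b-suc n aₙ≡bₙ = up (down n aₙ≡bₙ)
  where
  isolate : ∀ x a y → a ≡ (x ℤ.+ a ℤ.- y) ℤ.+ (y ℤ.- x)
  isolate = solve-∀
  up : a 0 ≡ b 0 → a ≗ b
  up eq zero    = eq
  up eq (suc m) = begin
    a (suc m)           ≡⟨ a-suc m ⟩
    x m ℤ.+ a m ℤ.- y m ≡⟨ cong (λ z → x m ℤ.+ z ℤ.- y m) (up eq m) ⟩
    x m ℤ.+ b m ℤ.- y m ≡⟨ b-suc m ⟨
    b (suc m)           ∎
  down : ∀ m → a m ≡ b m → a 0 ≡ b 0
  down zero    eq = eq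
  down (suc m) eq = down m (begin
    a m                                      ≡⟨ isolate (x m) (a m) (y m) ⟩
    (x m ℤ.+ a m ℤ.- y m) ℤ.+ (y m ℤ.- x m)  ≡⟨ cong (λ z → z ℤ.+ (y m ℤ.- x m)) (a-suc m) ⟨
    a (suc m) ℤ.+ (y m ℤ.- x m)              ≡⟨ cong (λ z → z ℤ.+ (y m ℤ.- x m)) eq ⟩
    b (suc m) ℤ.+ (y m ℤ.- x m)              ≡⟨ cong (λ z → z ℤ.+ (y m ℤ.- x m)) (b-suc m) ⟩
    (x m ℤ.+ b m ℤ.- y m) ℤ.+ (y m ℤ.- x m)  ≡⟨ isolate (x m) (b m) (y m) ⟨
    b m                                      ∎)

module _ (r′ : ℕ) where

  open ClosedForm r′

  private
    r : ℕ
    r = suc r′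

  -- The bound N makes the strong induction on n structural.
  s≡F-upTo : ∀ N n → n ≤ N → ∀ m → s r n (+ m) ≡ F m n
  s≡F-upTo N       zero    _         m = sym (F-0 m)
  s≡F-upTo (suc N) (suc n) (s≤s n≤N) =
    agreeAt⇒agree (λ m → s r (suc n) (+ m)) (λ m → F m (suc n))
      (λ m → s r n (+ suc m)) (λ m → sLagged r n r′ (+ m))
      (s-recurrence r′ n)
      (λ m → trans (F-recurrence m n) (cong₂ (λ x y → x ℤ.+ F m (suc n) ℤ.- y)
        (sym (s≡F-upTo N n n≤N (suc m)))
        (sym (sLagged≡coefficient r (F m) m n r′
          (λ k k≤n → s≡F-upTo N k (ℕ.≤-trans k≤n n≤N) m)))))
      n (trans (s-diagonal r′ n) (sym (F-diagonal n)))

mainTheorem3 : (r : ℕ) → r > 0 → (m : ℕ) →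
    (λ n → s r n (+ m)) ≗
    ((const (+ 1) ⊖ t ⊛^ r) ⊛^ m ⊘ (const (+ 1) ⊖ t) ⊛^ (m + 2))
    ⊛ ( const (+ r) ⊛ t ⊛^ r ⊛ (const (+ 1) ⊖ t)
    ⊕ (const (+ 1) ⊖ t ⊛^ r) ⊛ (const (+ 1) ⊖ const (+ 2) ⊛ t) )
mainTheorem3 (suc r′) _ m n =
  trans (s≡F-upTo r′ n n ℕ.≤-refl m) (ClosedForm.F≗closedForm r′ m n)
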